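{- As $n \to \infty$, $$ex(n,K_3,C_5) \le \frac{1}{2\sqrt{2}}\,(1+o(1))\, n^{3/2}.$$ That is, there is a function $\varepsilon(n)$ with $\varepsilon(n)\to 0$ as $n\to\infty$ such that for every positive integer $n$, every graph on $n$ vertices that contains no cycle of length five as a subgraph has at most $\frac{1}{2\sqrt{2}}(1+\varepsilon(n))\,n^{3/2}$ triangles.
   Context: Graphs are finite and simple. $ex(n,K_3,C_5)$ denotes the maximum possible number of triangles (copies of $K_3$ as subgraphs) in a graph on $n$ vertices that does not contain a cycle of length five $C_5$ as a (not necessarily induced) subgraph. The $o(1)$ term denotes a quantity depending only on $n$ and tending to $0$ as $n\to\infty$. -}

module Defs where

open import Level using (0ℓ)
open import Data.Nat as ℕ using (ℕ; suc)
open import Data.Nat.DivMod using (_mod_)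
open import Data.Integer using (+_)
open import Data.Rational using (ℚ; 0ℚ; _*_; _≤_; _<_; ∣_∣; _/_)
open import Data.Fin as Fin using (Fin; toℕ)
open import Data.Fin.Properties using (_<?_)
open import Data.List using (List; length; filter; allFin; cartesianProduct)
open import Data.Product using (∃-syntax; Σ-syntax; _×_; _,_)
open import Function.Definitions using (Injective)
open import Relation.Binary using (Rel; Decidable; Symmetric; Irreflexive)
open import Relation.Binary.PropositionalEquality using (_≡_)
open import Relation.Nullary using (¬_)
open import Relation.Nullary.Decidable using (_×-dec_)
open import Relation.Unary using (Pred) renaming (Decidable to Decidable₁)

record Graph (n : ℕ) : Set₁ where
  infix 4 _~_ _~?_
  field
    _~_      : Rel (Fin n) 0ℓ
    _~?_     : Decidable _~_
    ~-sym    : Symmetric _~_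
    ~-irrefl : Irreflexive _≡_ _~_

-- A copy of K₃ is determined by its vertex set, listed here in increasing
-- order so that each copy is counted exactly once.
module _ {n : ℕ} (G : Graph n) where
  open Graph G

  IsTriangle : Pred (Fin n × Fin n × Fin n) 0ℓ
  IsTriangle (i , j , k) =
    (i Fin.< j × j Fin.< k) × (i ~ j × j ~ k × i ~ k)

  isTriangle? : Decidable₁ IsTriangle
  isTriangle? (i , j , k) =
    ((i <? j) ×-dec (j <? k)) ×-dec ((i ~? j) ×-dec ((j ~? k) ×-dec (i ~? k)))

  triangles : List (Fin n × Fin n × Fin n)
  triangles = filter isTriangle?
    (cartesianProduct (allFin n) (cartesianProduct (allFin n) (allFin n)))

  #triangles : ℕ
  #triangles = length triangles

  HasC₅ : Set
  HasC₅ = Σ[ v ∈ (Fin 5 → Fin n) ]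
    Injective _≡_ _≡_ v × (∀ i → v i ~ v (suc (toℕ i) mod 5))

  C₅-Free : Set
  C₅-Free = ¬ HasC₅

TendsToZero : (ℕ → ℚ) → Set
TendsToZero ε = ∀ δ → 0ℚ < δ → ∃[ N ] (∀ n → N ℕ.≤ n → ∣ ε n ∣ < δ)

-- The inequality t ≤ q·√r between real numbers, for a natural number t and
-- rationals q and r > 0. As t ≥ 0 it forces q ≥ 0, and then both sides may
-- be squared.
infix 4 _≤_·√_
_≤_·√_ : ℕ → ℚ → ℚ → Set
t ≤ q ·√ r = 0ℚ ≤ q × (+ t / 1) * (+ t / 1) ≤ q * q * r

{-# OPTIONS --safe #-}

-- Let τ(e) be the number of triangles on an edge e. In a C₅-free graph an edge
-- with τ ≥ 3 meets only edges with τ = 1 in its triangles. Hence, when every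
-- triangle charges 3, 2 or 0 to each of its edges according as τ = 1, τ = 2 or
-- τ ≥ 3, it spends at least 6, while an edge receives W = 3, 4 or 0. So the sum
-- S of W over ordered pairs is at least 12 t, where t is the number of triangles.
-- Two distinct nonadjacent vertices x, y are joined by at most two paths x u y of
-- positive weight W(xu) W(uy), and if there are two, then their edges all have
-- τ = 1: the total weight is at most max(16, 3·3 + 3·3) = 18. The pairs x = y and
-- x ~ y contribute only O(S) to the sum of these weights, so by Cauchy–Schwarz
-- S² ≤ n (18 n² + 12 S), which gives 8 (t − n)² ≤ n³ for t ≥ n.
module Submission where

open import Defs
open import Data.Bool using (if_then_else_; true; false)
open import Data.Fin as Fin using (Fin; zero; suc)
open import Data.Fin.Patterns using (0F; 1F; 2F; 3F; 4F)
open import Data.Fin.Properties as Finₚ using (_≟_)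
open import Data.Integer as ℤ using ()
import Data.Integer.Properties as ℤₚ
open import Data.List as List using (List; []; _∷_; length; filter; allFin; cartesianProduct)
open import Data.List.Properties using (map-++; map-∘; map-tabulate)
open import Data.List.Relation.Unary.All using (All; []; _∷_)
open import Data.Nat using (ℕ; zero; suc; _+_; _*_; _∸_; _^_; _≤_; _<_; _≥_; z≤n; s≤s; s≤s⁻¹; _≤?_; _<?_)
import Data.Nat.ListAction as ListAction
open import Data.Nat.ListAction.Properties using (sum-++)
open import Data.Nat.Properties hiding (_≟_)
open import Algebra.Properties.Semiring.Sum +-*-semiring
open import Data.Nat.Tactic.RingSolver using (solve-∀)
open import Data.Product using (Σ-syntax; ∃-syntax; _×_; _,_; proj₁; proj₂)
open import Data.Rational as ℚ using (ℚ; 0ℚ; 1ℚ; _/_; mkℚ)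
import Data.Rational.Properties as ℚₚ
open import Data.Rational.Unnormalised as ℚᵘ using (ℚᵘ; mkℚᵘ)
import Data.Rational.Unnormalised.Properties as ℚᵘₚ
open import Data.Sum using (inj₁; inj₂)
open import Data.Vec using (lookup; _∷_; [])
open import Data.Vec.Relation.Unary.All using (_∷_; [])
open import Data.Vec.Relation.Unary.AllPairs using (_∷_; [])
open import Data.Vec.Relation.Unary.Unique.Propositional.Properties using (lookup-injective)
open import Function using (_∘_; id; case_of_)
open import Relation.Binary.PropositionalEquality
open import Relation.Nullary using (¬_; Dec; yes; no; does; contradiction)
open import Relation.Nullary.Decidable using (_×-dec_)
open import Relation.Unary using (Pred) renaming (Decidable to Decidable₁)

-- Finite sums over ℕ and the Cauchy-Schwarz inequality

sum-mono-≤ : ∀ {n} {f g : Fin n → ℕ} → (∀ i → f i ≤ g i) → sum f ≤ sum g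
sum-mono-≤ {zero}  f≤g = z≤n
sum-mono-≤ {suc n} f≤g = +-mono-≤ (f≤g zero) (sum-mono-≤ (f≤g ∘ suc))

f≤sum : ∀ {n} (f : Fin n → ℕ) i → f i ≤ sum f
f≤sum f zero    = m≤m+n (f zero) _
f≤sum f (suc i) = ≤-trans (f≤sum (f ∘ suc) i) (m≤n+m _ (f zero))

sum-const : ∀ n c → ∑[ i < n ] c ≡ n * c
sum-const zero    c = refl
sum-const (suc n) c = cong (c +_) (sum-const n c)

sum-*-sum : ∀ {m n} (f : Fin m → ℕ) (g : Fin n → ℕ) →
  sum f * sum g ≡ ∑[ i < m ] ∑[ j < n ] (f i * g j)
sum-*-sum f g = trans (*-distribʳ-sum (sum g) f) (sum-cong-≗ λ i → *-distribˡ-sum (f i) g)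

-- Write the larger number as the smaller plus `o`: the two sides then differ by `o * o`, and no
-- subtraction in ℕ is needed.
2*m*n≤m*m+n*n : ∀ m n → m * n + m * n ≤ m * m + n * n
2*m*n≤m*m+n*n m n with ≤-total m n
... | inj₁ m≤n with m≤n⇒∃[o]m+o≡n m≤n
...   | o , refl = m+n≤o⇒m≤o _ (≤-reflexive (identity m o))
  where
  identity : ∀ a c → a * (a + c) + a * (a + c) + c * c ≡ a * a + (a + c) * (a + c)
  identity = solve-∀
2*m*n≤m*m+n*n m n | inj₂ n≤m with m≤n⇒∃[o]m+o≡n n≤m
...   | o , refl = m+n≤o⇒m≤o _ (≤-reflexive (identity n o))
  where
  identity : ∀ a c → (a + c) * a + (a + c) * a + c * c ≡ (a + c) * (a + c) + a * a
  identity = solve-∀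

-- Sum `2*m*n≤m*m+n*n` over all ordered pairs of indices: every square then occurs `n` times through
-- each of the two coordinates.
cauchy-schwarz : ∀ {n} (f : Fin n → ℕ) → sum f * sum f ≤ n * ∑[ i < n ] (f i * f i)
cauchy-schwarz {n} f = *-cancelˡ-≤ 2 (begin
  2 * (sum f * sum f)
    ≡⟨ cong (2 *_) (sum-*-sum f f) ⟩
  2 * (∑[ i < n ] ∑[ j < n ] (f i * f j))
    ≡⟨ cong (products +_) (+-identityʳ products) ⟩
  products + products
    ≡⟨ ∑∑-distrib-+ _ _ ⟨
  ∑[ i < n ] ∑[ j < n ] (f i * f j + f i * f j)
    ≤⟨ sum-mono-≤ (λ i → sum-mono-≤ λ j → 2*m*n≤m*m+n*n (f i) (f j)) ⟩
  ∑[ i < n ] ∑[ j < n ] (f i * f i + f j * f j)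
    ≡⟨ ∑∑-distrib-+ _ _ ⟩
  (∑[ i < n ] ∑[ j < n ] (f i * f i)) + (∑[ i < n ] ∑[ j < n ] (f j * f j))
    ≡⟨ cong (_+ (∑[ i < n ] squares)) (∑-comm {n} {n} λ i j → f i * f i) ⟩
  (∑[ i < n ] squares) + (∑[ i < n ] squares)
    ≡⟨ cong₂ _+_ (sum-const n squares) (sum-const n squares) ⟩
  n * squares + n * squares
    ≡⟨ cong (n * squares +_) (+-identityʳ (n * squares)) ⟨
  2 * (n * squares) ∎)
  where
  open ≤-Reasoning
  products = ∑[ i < n ] ∑[ j < n ] (f i * f j)
  squares = ∑[ i < n ] (f i * f i)
  ∑∑-distrib-+ : ∀ (g h : Fin n → Fin n → ℕ) → ∑[ i < n ] ∑[ j < n ] (g i j + h i j)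
    ≡ (∑[ i < n ] ∑[ j < n ] g i j) + (∑[ i < n ] ∑[ j < n ] h i j)
  ∑∑-distrib-+ g h = trans (sum-cong-≗ λ i → ∑-distrib-+ (g i) (h i)) (∑-distrib-+ (sum ∘ g) (sum ∘ h))

∑³ : ∀ {n} → (Fin n → Fin n → Fin n → ℕ) → ℕ
∑³ {n} f = ∑[ i < n ] ∑[ j < n ] ∑[ k < n ] f i j k

module _ {n : ℕ} where
  private variable f g : Fin n → Fin n → Fin n → ℕ

  ∑³-cong : (∀ i j k → f i j k ≡ g i j k) → ∑³ f ≡ ∑³ g
  ∑³-cong f≡g = sum-cong-≗ λ i → sum-cong-≗ λ j → sum-cong-≗ (f≡g i j)

  ∑³-mono-≤ : (∀ i j k → f i j k ≤ g i j k) → ∑³ f ≤ ∑³ g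
  ∑³-mono-≤ f≤g = sum-mono-≤ λ i → sum-mono-≤ λ j → sum-mono-≤ (f≤g i j)

  ∑³-swap₁₂ : ∀ f → ∑³ {n} f ≡ ∑³ λ i j k → f j i k
  ∑³-swap₁₂ f = ∑-comm λ i j → sum (f i j)

  ∑³-swap₂₃ : ∀ f → ∑³ {n} f ≡ ∑³ λ i j k → f i k j
  ∑³-swap₂₃ f = sum-cong-≗ λ i → ∑-comm (f i)

  ∑³-distrib-+ : ∀ f g → ∑³ {n} (λ i j k → f i j k + g i j k) ≡ ∑³ f + ∑³ g
  ∑³-distrib-+ f g = trans
    (sum-cong-≗ λ i → trans (sum-cong-≗ λ j → ∑-distrib-+ (f i j) (g i j))
                            (∑-distrib-+ (sum ∘ f i) (sum ∘ g i)))
    (∑-distrib-+ (λ i → sum (sum ∘ f i)) (λ i → sum (sum ∘ g i)))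

  ∑³-distribˡ-* : ∀ c f → c * ∑³ f ≡ ∑³ {n} (λ i j k → c * f i j k)
  ∑³-distribˡ-* c f = trans (*-distribˡ-sum {n} c _) (sum-cong-≗ λ i →
    trans (*-distribˡ-sum {n} c _) (sum-cong-≗ λ j → *-distribˡ-sum c (f i j)))

-- Indicators and counting with them

𝟙 : ∀ {p} {P : Set p} → Dec P → ℕ
𝟙 d = if does d then 1 else 0

module _ {p} {P : Set p} where

  𝟙≤1 : (d : Dec P) → 𝟙 d ≤ 1
  𝟙≤1 (yes _) = ≤-refl
  𝟙≤1 (no _)  = z≤n

  0<𝟙⇒holds : (d : Dec P) → 0 < 𝟙 d → P
  0<𝟙⇒holds (yes p) _ = p

  holds⇒0<𝟙 : (d : Dec P) → P → 0 < 𝟙 d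
  holds⇒0<𝟙 (yes _) _ = ≤-refl
  holds⇒0<𝟙 (no ¬p) p = contradiction p ¬p

  *𝟙-mono-≤ : ∀ {m o} (d : Dec P) → (P → m ≤ o) → m * 𝟙 d ≤ o * 𝟙 d
  *𝟙-mono-≤ (yes p) m≤o = *-monoˡ-≤ 1 (m≤o p)
  *𝟙-mono-≤ {m} (no _) _ = ≤-trans (≤-reflexive (*-zeroʳ m)) z≤n

  -- Bounds a summand by a constant times the indicator of a set containing its support. Both
  -- hypotheses assume `0 < m` because a vanishing summand satisfies the bound anyway.
  ≤-*𝟙 : ∀ {m o} (d : Dec P) → (0 < m → P) → (0 < m → m ≤ o) → m ≤ o * 𝟙 d
  ≤-*𝟙 {zero}  d _ _ = z≤n
  ≤-*𝟙 {suc m} {o} (yes _) _ m≤o = ≤-trans (m≤o (s≤s z≤n)) (≤-reflexive (sym (*-identityʳ o)))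
  ≤-*𝟙 {suc m} (no ¬p) h _ = contradiction (h (s≤s z≤n)) ¬p

𝟙-mono-≤ : ∀ {p q} {P : Set p} {Q : Set q} (d : Dec P) (e : Dec Q) → (P → Q) → 𝟙 d ≤ 𝟙 e
𝟙-mono-≤ d e P⇒Q = ≤-trans (≤-*𝟙 e (P⇒Q ∘ 0<𝟙⇒holds d) (λ _ → 𝟙≤1 d)) (≤-reflexive (*-identityˡ (𝟙 e)))

𝟙-cong : ∀ {p q} {P : Set p} {Q : Set q} (d : Dec P) (e : Dec Q) → (P → Q) → (Q → P) → 𝟙 d ≡ 𝟙 e
𝟙-cong d e P⇒Q Q⇒P = ≤-antisym (𝟙-mono-≤ d e P⇒Q) (𝟙-mono-≤ e d Q⇒P)

𝟙-×-dec : ∀ {p q} {P : Set p} {Q : Set q} (d : Dec P) (e : Dec Q) → 𝟙 (d ×-dec e) ≡ 𝟙 d * 𝟙 e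
𝟙-×-dec (yes _) (yes _) = refl
𝟙-×-dec (yes _) (no _)  = refl
𝟙-×-dec (no _)  e       = refl

𝟙-exclusive : ∀ {p q} {P : Set p} {Q : Set q} (d : Dec P) (e : Dec Q) → (P → ¬ Q) → 𝟙 d + 𝟙 e ≤ 1
𝟙-exclusive (yes p) (yes q) P⇒¬Q = contradiction q (P⇒¬Q p)
𝟙-exclusive (yes _) (no _)  _    = ≤-refl
𝟙-exclusive (no _)  e       _    = 𝟙≤1 e

sum-𝟙-≟ : ∀ {n} (x : Fin n) → ∑[ i < n ] 𝟙 (x ≟ i) ≡ 1
sum-𝟙-≟ {suc n} zero    = cong suc (trans (sum-const n 0) (*-zeroʳ n))
sum-𝟙-≟ {suc n} (suc x) = sum-𝟙-≟ x

0<sum⇒∃ : ∀ {n} (f : Fin n → ℕ) → 0 < sum f → ∃[ i ] 0 < f i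
0<sum⇒∃ {suc n} f 0<∑ with f zero in eq
... | suc _ = zero , subst (0 <_) (sym eq) (s≤s z≤n)
... | zero  with 0<sum⇒∃ (f ∘ suc) 0<∑
...   | i , 0<fi = suc i , 0<fi

-- Since `f` is at most 1, setting it to 0 at the head of the list lowers the sum by at most 1, so
-- the tail still satisfies the length condition. This is how vertices avoiding given ones are
-- chosen below.
∃-outside : ∀ {n} (f : Fin n → ℕ) → (∀ i → f i ≤ 1) → (xs : List (Fin n)) →
  length xs < sum f → ∃[ i ] 0 < f i × All (i ≢_) xs
∃-outside f f≤1 [] 0<∑ with 0<sum⇒∃ f 0<∑
... | i , 0<fi = i , 0<fi , []
∃-outside {n} f f≤1 (x ∷ xs) len<∑ = found (∃-outside f′ f′≤1 xs (s≤s⁻¹ (≤-trans len<∑ split)))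
  where
  f′ : Fin n → ℕ
  f′ i = if does (x ≟ i) then 0 else f i
  f′≤1 : ∀ i → f′ i ≤ 1
  f′≤1 i with does (x ≟ i)
  ... | true  = z≤n
  ... | false = f≤1 i
  f≤𝟙+f′ : ∀ i → f i ≤ 𝟙 (x ≟ i) + f′ i
  f≤𝟙+f′ i with does (x ≟ i)
  ... | true  = f≤1 i
  ... | false = ≤-refl
  split : sum f ≤ suc (sum f′)
  split = ≤-trans (sum-mono-≤ f≤𝟙+f′) (≤-reflexive
    (trans (∑-distrib-+ (λ i → 𝟙 (x ≟ i)) f′) (cong (_+ sum f′) (sum-𝟙-≟ x))))
  found : ∃[ i ] 0 < f′ i × All (i ≢_) xs → ∃[ i ] 0 < f i × All (i ≢_) (x ∷ xs)
  found (i , 0<f′i , i∉xs) with x ≟ i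
  ... | no x≢i = i , 0<f′i , (x≢i ∘ sym) ∷ i∉xs

-- Lengths of filtered lists as sums of indicators

length-filter≡sum-𝟙 : ∀ {a p} {A : Set a} {P : Pred A p} (P? : Decidable₁ P) xs →
  length (filter P? xs) ≡ ListAction.sum (List.map (λ x → 𝟙 (P? x)) xs)
length-filter≡sum-𝟙 P? []       = refl
length-filter≡sum-𝟙 P? (x ∷ xs) with does (P? x)
... | true  = cong suc (length-filter≡sum-𝟙 P? xs)
... | false = length-filter≡sum-𝟙 P? xs

sum-map-allFin : ∀ {n} (f : Fin n → ℕ) → ListAction.sum (List.map f (allFin n)) ≡ sum f
sum-map-allFin f = trans (cong ListAction.sum (map-tabulate id f)) (sum-tabulate f)
  where
  sum-tabulate : ∀ {n} (f : Fin n → ℕ) → ListAction.sum (List.tabulate f) ≡ sum f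
  sum-tabulate {zero}  f = refl
  sum-tabulate {suc n} f = cong (f zero +_) (sum-tabulate (f ∘ suc))

sum-map-cartesianProduct : ∀ {n a} {A : Set a} (f : Fin n × A → ℕ) (ys : List A) →
  ListAction.sum (List.map f (cartesianProduct (allFin n) ys)) ≡
  ∑[ i < n ] ListAction.sum (List.map (λ y → f (i , y)) ys)
sum-map-cartesianProduct {n} f ys = trans (go (allFin n))
  (sum-map-allFin λ i → ListAction.sum (List.map (λ y → f (i , y)) ys))
  where
  go : ∀ xs → ListAction.sum (List.map f (cartesianProduct xs ys)) ≡
    ListAction.sum (List.map (λ i → ListAction.sum (List.map (λ y → f (i , y)) ys)) xs)
  go []       = refl
  go (x ∷ xs) = begin
    ListAction.sum (List.map f (List.map (x ,_) ys List.++ cartesianProduct xs ys))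
      ≡⟨ cong ListAction.sum (map-++ f (List.map (x ,_) ys) _) ⟩
    ListAction.sum (List.map f (List.map (x ,_) ys) List.++ List.map f (cartesianProduct xs ys))
      ≡⟨ sum-++ (List.map f (List.map (x ,_) ys)) _ ⟩
    ListAction.sum (List.map f (List.map (x ,_) ys)) + ListAction.sum (List.map f (cartesianProduct xs ys))
      ≡⟨ cong₂ _+_ (cong ListAction.sum (sym (map-∘ ys))) (go xs) ⟩
    _ ∎
    where open ≡-Reasoning

-- Charges and weights

-- A triangle charges share m to each of its edges lying in exactly m triangles,
-- so such an edge receives m * share m. The value at 0 is irrelevant.
share : ℕ → ℕ
share 1 = 3
share 2 = 2
share _ = 0

*-share≤4 : ∀ m → m * share m ≤ 4
*-share≤4 0 = z≤n
*-share≤4 1 = s≤s (s≤s (s≤s z≤n))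
*-share≤4 2 = ≤-refl
*-share≤4 (suc (suc (suc m))) = ≤-trans (≤-reflexive (*-zeroʳ m)) z≤n

*-share≤3 : ∀ {m} → m ≤ 1 → m * share m ≤ 3
*-share≤3 {0} _ = z≤n
*-share≤3 {1} _ = ≤-refl
*-share≤3 {suc (suc _)} (s≤s ())

0<*-share⇒0< : ∀ m → 0 < m * share m → 0 < m
0<*-share⇒0< (suc m) _ = s≤s z≤n

2≤share : ∀ {m} → 0 < m → m ≤ 2 → 2 ≤ share m
2≤share {1} _ _ = s≤s (s≤s z≤n)
2≤share {2} _ _ = ≤-refl
2≤share {suc (suc (suc _))} _ (s≤s (s≤s ()))

3≤share : ∀ {m} → 0 < m → m ≤ 1 → 3 ≤ share m
3≤share {1} _ _ = ≤-refl
3≤share {suc (suc _)} _ (s≤s ())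

-- Either all three shares are at least 2, or one argument exceeds 2 and each of the other two
-- shares is 3.
share-sum : ∀ {a b c} → 0 < a → 0 < b → 0 < c →
  (2 < a → b ≤ 1 × c ≤ 1) → (2 < b → a ≤ 1 × c ≤ 1) → (2 < c → a ≤ 1 × b ≤ 1) →
  6 ≤ share a + (share b + share c)
share-sum {a} {b} {c} 0<a 0<b 0<c ha hb hc with a ≤? 2 | b ≤? 2 | c ≤? 2
... | yes a≤2 | yes b≤2 | yes c≤2 = +-mono-≤ (2≤share 0<a a≤2) (+-mono-≤ (2≤share 0<b b≤2) (2≤share 0<c c≤2))
... | no a≰2 | _ | _ = let b≤1 , c≤1 = ha (≰⇒> a≰2) in
  ≤-trans (+-mono-≤ (3≤share 0<b b≤1) (3≤share 0<c c≤1)) (m≤n+m _ (share a))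
... | _ | no b≰2 | _ = let a≤1 , c≤1 = hb (≰⇒> b≰2) in
  +-mono-≤ (3≤share 0<a a≤1) (≤-trans (3≤share 0<c c≤1) (m≤n+m _ (share b)))
... | _ | _ | no c≰2 = let a≤1 , b≤1 = hc (≰⇒> c≰2) in
  +-mono-≤ (3≤share 0<a a≤1) (≤-trans (3≤share 0<b b≤1) (m≤m+n _ (share c)))

-- Pentagons, and triangles counted with and without order

module _ {n : ℕ} (G : Graph n) where
  open Graph G
  private variable a b c d e i j k u v w x y : Fin n

  ~⇒≢ : i ~ j → i ≢ j
  ~⇒≢ i~j i≡j = ~-irrefl i≡j i~j

  -- Consecutive vertices differ by irreflexivity, so only the five diagonals are hypotheses.
  pentagon : a ~ b → b ~ c → c ~ d → d ~ e → e ~ a →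
    a ≢ c → a ≢ d → b ≢ d → b ≢ e → c ≢ e → HasC₅ G
  pentagon {a} {b} {c} {d} {e} a~b b~c c~d d~e e~a a≢c a≢d b≢d b≢e c≢e =
    lookup (a ∷ b ∷ c ∷ d ∷ e ∷ []) , (λ {i} {j} → lookup-injective distinct i j) ,
    λ { 0F → a~b ; 1F → b~c ; 2F → c~d ; 3F → d~e ; 4F → e~a }
    where
    distinct =
      (~⇒≢ a~b ∷ a≢c ∷ a≢d ∷ ~⇒≢ (~-sym e~a) ∷ []) ∷ (~⇒≢ b~c ∷ b≢d ∷ b≢e ∷ []) ∷
      (~⇒≢ c~d ∷ c≢e ∷ []) ∷ (~⇒≢ d~e ∷ []) ∷ [] ∷ []

  Triangle : Fin n → Fin n → Fin n → Set
  Triangle i j k = i ~ j × j ~ k × i ~ k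

  triangle? : ∀ i j k → Dec (Triangle i j k)
  triangle? i j k = i ~? j ×-dec (j ~? k ×-dec i ~? k)

  swap₁₂ : Triangle i j k → Triangle j i k
  swap₁₂ (i~j , j~k , i~k) = ~-sym i~j , i~k , j~k

  swap₂₃ : Triangle i j k → Triangle i k j
  swap₂₃ (i~j , j~k , i~k) = i~k , ~-sym j~k , i~j

  Δ : Fin n → Fin n → Fin n → ℕ
  Δ i j k = 𝟙 (triangle? i j k)

  Δ-swap₁₂ : ∀ i j k → Δ i j k ≡ Δ j i k
  Δ-swap₁₂ i j k = 𝟙-cong (triangle? i j k) (triangle? j i k) swap₁₂ swap₁₂

  Δ-swap₂₃ : ∀ i j k → Δ i j k ≡ Δ i k j
  Δ-swap₂₃ i j k = 𝟙-cong (triangle? i j k) (triangle? i k j) swap₂₃ swap₂₃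

  #orderedTriangles : ℕ
  #orderedTriangles = ∑³ Δ

  -- Relabel the summation variables, then use the symmetry of `Δ`. Together with `∑³-Δ-swap₂₃` this
  -- reaches all six orders of the arguments of `o`.
  ∑³-Δ-swap₁₂ : (o : Fin n → Fin n → Fin n → ℕ) →
    ∑³ (λ i j k → o i j k * Δ i j k) ≡ ∑³ (λ i j k → o j i k * Δ i j k)
  ∑³-Δ-swap₁₂ o = trans (∑³-swap₁₂ λ i j k → o i j k * Δ i j k)
    (∑³-cong λ i j k → cong (o j i k *_) (Δ-swap₁₂ j i k))

  ∑³-Δ-swap₂₃ : (o : Fin n → Fin n → Fin n → ℕ) →
    ∑³ (λ i j k → o i j k * Δ i j k) ≡ ∑³ (λ i j k → o i k j * Δ i j k)
  ∑³-Δ-swap₂₃ o = trans (∑³-swap₂₃ λ i j k → o i j k * Δ i j k)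
    (∑³-cong λ i j k → cong (o i k j *_) (Δ-swap₂₃ i k j))

  -- One factor for each pair of vertices makes every permuted copy a term of the product expanded
  -- in `permutations-increasing≤1`.
  increasing : Fin n → Fin n → Fin n → ℕ
  increasing i j k = 𝟙 (i Finₚ.<? j) * (𝟙 (j Finₚ.<? k) * 𝟙 (i Finₚ.<? k))

  #triangles≤ : #triangles G ≤ ∑³ λ i j k → increasing i j k * Δ i j k
  #triangles≤ = begin
    #triangles G
      ≡⟨ length-filter≡sum-𝟙 (isTriangle? G)
           (cartesianProduct (allFin n) (cartesianProduct (allFin n) (allFin n))) ⟩
    _ ≡⟨ sum-map-cartesianProduct (𝟙 ∘ isTriangle? G) (cartesianProduct (allFin n) (allFin n)) ⟩
    _ ≡⟨ sum-cong-≗ (λ i → trans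
           (sum-map-cartesianProduct (λ jk → 𝟙 (isTriangle? G (i , jk))) (allFin n))
           (sum-cong-≗ λ j → sum-map-allFin λ k → 𝟙 (isTriangle? G (i , j , k)))) ⟩
    ∑³ (λ i j k → 𝟙 (isTriangle? G (i , j , k)))
      ≤⟨ ∑³-mono-≤ bound ⟩
    ∑³ (λ i j k → increasing i j k * Δ i j k) ∎
    where
    open ≤-Reasoning
    bound : ∀ i j k → 𝟙 (isTriangle? G (i , j , k)) ≤ increasing i j k * Δ i j k
    bound i j k = begin
      𝟙 (i<j×j<k ×-dec triangle? i j k)  ≡⟨ 𝟙-×-dec i<j×j<k (triangle? i j k) ⟩
      𝟙 i<j×j<k * Δ i j k                ≤⟨ *-monoˡ-≤ (Δ i j k) (𝟙-mono-≤ i<j×j<k ordered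
                                               λ (i<j , j<k) → i<j , j<k , Finₚ.<-trans i<j j<k) ⟩
      𝟙 ordered * Δ i j k                ≡⟨ cong (_* Δ i j k) (trans (𝟙-×-dec i<j? (j<k? ×-dec i<k?))
                                               (cong (𝟙 i<j? *_) (𝟙-×-dec j<k? i<k?))) ⟩
      increasing i j k * Δ i j k         ∎
      where
      i<j? : Dec (i Fin.< j)
      i<j? = i Finₚ.<? j
      j<k? : Dec (j Fin.< k)
      j<k? = j Finₚ.<? k
      i<k? : Dec (i Fin.< k)
      i<k? = i Finₚ.<? k
      i<j×j<k = i<j? ×-dec j<k?
      ordered = i<j? ×-dec (j<k? ×-dec i<k?)

  permutations : (Fin n → Fin n → Fin n → ℕ) → Fin n → Fin n → Fin n → ℕ
  permutations o i j k = o i j k + (o j i k + (o i k j + (o k i j + (o j k i + o k j i))))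

  ∑³-Δ-permutations : ∀ o →
    6 * ∑³ (λ i j k → o i j k * Δ i j k) ≡ ∑³ (λ i j k → permutations o i j k * Δ i j k)
  ∑³-Δ-permutations o = begin
    6 * T o
      ≡⟨ cong (λ z → T o + (T o + (T o + (T o + (T o + z))))) (+-identityʳ (T o)) ⟩
    T o + (T o + (T o + (T o + (T o + T o))))
      ≡⟨ cong (T o +_) (cong₂ _+_ e₁ (cong₂ _+_ e₂ (cong₂ _+_ e₃ (cong₂ _+_ e₄ e₅)))) ⟩
    T o + (T o₁ + (T o₂ + (T o₃ + (T o₄ + T o₅))))
      ≡⟨ T-distrib-+ o _ (T-distrib-+ o₁ _ (T-distrib-+ o₂ _ (T-distrib-+ o₃ _ (T-distrib-+ o₄ o₅ refl)))) ⟨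
    T (permutations o) ∎
    where
    open ≡-Reasoning
    o₁ o₂ o₃ o₄ o₅ : Fin n → Fin n → Fin n → ℕ
    o₁ i j k = o j i k
    o₂ i j k = o i k j
    o₃ i j k = o k i j
    o₄ i j k = o j k i
    o₅ i j k = o k j i
    T : (Fin n → Fin n → Fin n → ℕ) → ℕ
    T o = ∑³ λ i j k → o i j k * Δ i j k
    T-distrib-+ : ∀ o p {z} → T p ≡ z → T (λ i j k → o i j k + p i j k) ≡ T o + z
    T-distrib-+ o p refl = trans
      (∑³-cong λ i j k → *-distribʳ-+ (Δ i j k) (o i j k) (p i j k))
      (∑³-distrib-+ (λ i j k → o i j k * Δ i j k) (λ i j k → p i j k * Δ i j k))
    e₁ : T o ≡ T o₁
    e₁ = ∑³-Δ-swap₁₂ o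
    e₂ : T o ≡ T o₂
    e₂ = ∑³-Δ-swap₂₃ o
    e₃ : T o ≡ T o₃
    e₃ = trans e₁ (∑³-Δ-swap₂₃ o₁)
    e₄ : T o ≡ T o₄
    e₄ = trans e₂ (∑³-Δ-swap₁₂ o₂)
    e₅ : T o ≡ T o₅
    e₅ = trans e₄ (∑³-Δ-swap₂₃ o₄)

  -- The six copies are the transitive terms among the eight obtained by choosing a direction for
  -- each pair; the other two terms are the cyclic ones. Each factor of the product is at most 1
  -- because the two strict orders of a pair exclude each other.
  permutations-increasing≤1 : ∀ i j k → permutations increasing i j k ≤ 1
  permutations-increasing≤1 i j k = begin
    permutations increasing i j k
      ≤⟨ m+n≤o⇒m≤o _ (≤-reflexive (expand (L i j) (L j i) (L j k) (L k j) (L i k) (L k i))) ⟩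
    (L i j + L j i) * ((L j k + L k j) * (L i k + L k i))
      ≤⟨ *-mono-≤ (exclusive i j) (*-mono-≤ (exclusive j k) (exclusive i k)) ⟩
    1 ∎
    where
    open ≤-Reasoning
    L : Fin n → Fin n → ℕ
    L i j = 𝟙 (i Finₚ.<? j)
    exclusive : ∀ i j → L i j + L j i ≤ 1
    exclusive i j = 𝟙-exclusive (i Finₚ.<? j) (j Finₚ.<? i) Finₚ.<-asym
    expand : ∀ p p′ q q′ r r′ →
      (p * (q * r) + (p′ * (r * q) + (r * (q′ * p) + (r′ * (p * q′) + (q * (r′ * p′) + q′ * (p′ * r′)))))) +
      (p * (q * r′) + p′ * (q′ * r)) ≡ (p + p′) * ((q + q′) * (r + r′))
    expand = solve-∀

  6*#triangles≤#orderedTriangles : 6 * #triangles G ≤ #orderedTriangles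
  6*#triangles≤#orderedTriangles = begin
    6 * #triangles G
      ≤⟨ *-monoʳ-≤ 6 #triangles≤ ⟩
    6 * ∑³ (λ i j k → increasing i j k * Δ i j k)
      ≡⟨ ∑³-Δ-permutations increasing ⟩
    ∑³ (λ i j k → permutations increasing i j k * Δ i j k)
      ≤⟨ ∑³-mono-≤ (λ i j k → *-monoˡ-≤ (Δ i j k) (permutations-increasing≤1 i j k)) ⟩
    ∑³ (λ i j k → 1 * Δ i j k)
      ≡⟨ ∑³-cong (λ i j k → *-identityˡ (Δ i j k)) ⟩
    #orderedTriangles ∎
    where open ≤-Reasoning

  -- Edge weights and weighted paths of length two

  τ : Fin n → Fin n → ℕ
  τ i j = ∑[ k < n ] Δ i j k

  τ-sym : ∀ i j → τ i j ≡ τ j i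
  τ-sym i j = sum-cong-≗ (Δ-swap₁₂ i j)

  triangle⇒0<τ : Triangle i j k → 0 < τ i j
  triangle⇒0<τ {i} {j} {k} t = ≤-trans (holds⇒0<𝟙 (triangle? i j k) t) (f≤sum (Δ i j) k)

  ∃-triangle : (xs : List (Fin n)) → length xs < τ i j → ∃[ k ] Triangle i j k × All (k ≢_) xs
  ∃-triangle {i} {j} xs len<τ =
    let k , 0<Δ , k∉xs = ∃-outside (Δ i j) (λ k → 𝟙≤1 (triangle? i j k)) xs len<τ
    in k , 0<𝟙⇒holds (triangle? i j k) 0<Δ , k∉xs

  -- The total charge received by a pair. It is 0 at nonadjacent pairs, where `τ` vanishes, so sums
  -- of weights may run over all vertices.
  W : Fin n → Fin n → ℕ
  W i j = τ i j * share (τ i j)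

  W-sym : ∀ i j → W i j ≡ W j i
  W-sym i j = cong (λ m → m * share m) (τ-sym i j)

  0<W⇒0<τ : 0 < W i j → 0 < τ i j
  0<W⇒0<τ {i} {j} = 0<*-share⇒0< (τ i j)

  0<W⇒~ : 0 < W i j → i ~ j
  0<W⇒~ 0<W = proj₁ (proj₁ (proj₂ (∃-triangle [] (0<W⇒0<τ 0<W))))

  degree : Fin n → ℕ
  degree i = ∑[ j < n ] W i j

  totalDegree : ℕ
  totalDegree = ∑[ i < n ] degree i

  -- The weighted analogue of the number of common neighbours: each path `x u y` counts with the
  -- product of its edge weights.
  codegree : Fin n → Fin n → ℕ
  codegree x y = ∑[ u < n ] (W x u * W u y)

  -- Double counting of weighted paths of length two, by the middle vertex and by the two ends.
  ∑-degree² : ∑[ i < n ] (degree i * degree i) ≡ ∑[ x < n ] ∑[ y < n ] codegree x y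
  ∑-degree² = begin
    ∑[ u < n ] (degree u * degree u)
      ≡⟨ sum-cong-≗ (λ u → sum-*-sum (W u) (W u)) ⟩
    ∑³ (λ u x y → W u x * W u y)
      ≡⟨ ∑³-cong (λ u x y → cong (_* W u y) (W-sym u x)) ⟩
    ∑³ (λ u x y → W x u * W u y)
      ≡⟨ ∑³-swap₁₂ (λ u x y → W x u * W u y) ⟩
    ∑³ (λ x u y → W x u * W u y)
      ≡⟨ ∑³-swap₂₃ (λ x u y → W x u * W u y) ⟩
    ∑³ (λ x y u → W x u * W u y) ∎
    where open ≡-Reasoning

  0<W*W⇒~ : 0 < W x u * W u y → x ~ u × u ~ y
  0<W*W⇒~ {x} {u} {y} 0<WW with W x u in eq₁ | W u y in eq₂
  ... | suc _ | suc _ = 0<W⇒~ (subst (0 <_) (sym eq₁) (s≤s z≤n)) , 0<W⇒~ (subst (0 <_) (sym eq₂) (s≤s z≤n))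
  ... | suc a | zero  = contradiction (≤-trans 0<WW (≤-reflexive (*-zeroʳ a))) λ ()

  W*W≤16 : ∀ x u y → W x u * W u y ≤ 16
  W*W≤16 x u y = *-mono-≤ (*-share≤4 (τ x u)) (*-share≤4 (τ u y))

  codegree-diagonal : ∀ x → codegree x x ≤ 4 * degree x
  codegree-diagonal x = begin
    ∑[ u < n ] (W x u * W u x)  ≤⟨ sum-mono-≤ (λ u → *-monoʳ-≤ (W x u) (*-share≤4 (τ u x))) ⟩
    ∑[ u < n ] (W x u * 4)      ≡⟨ *-distribʳ-sum 4 (W x) ⟨
    degree x * 4                ≡⟨ *-comm (degree x) 4 ⟩
    4 * degree x                ∎
    where open ≤-Reasoning

  -- Every `u` with a nonzero term closes a triangle on `x y`, so there are at most `τ x y` such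
  -- terms, each at most 4 · 4.
  codegree-adjacent : x ~ y → codegree x y ≤ 16 * τ x y
  codegree-adjacent {x} {y} x~y = begin
    ∑[ u < n ] (W x u * W u y)  ≤⟨ sum-mono-≤ (λ u → ≤-*𝟙 (triangle? x y u)
                                     (λ 0<WW → let x~u , u~y = 0<W*W⇒~ 0<WW in x~y , ~-sym u~y , x~u)
                                     λ _ → W*W≤16 x u y) ⟩
    ∑[ u < n ] (16 * Δ x y u) ≡⟨ *-distribˡ-sum 16 (Δ x y) ⟨
    16 * τ x y                  ∎
    where open ≤-Reasoning

  -- Consequences of excluding C₅

  module _ (C₅-free : C₅-Free G) where

    -- Three triangles on ij leave one whose third vertex d differs from both k
    -- and x, where jkx is a second triangle on jk: then i d j x k is a C₅.
    τ-heavy : Triangle i j k → 2 < τ i j → τ j k ≤ 1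
    τ-heavy {i} {j} {k} (i~j , j~k , i~k) 2<τ = ≮⇒≥ λ 1<τ → case ∃-triangle (i ∷ []) 1<τ of λ
      { (x , (_ , k~x , j~x) , x≢i ∷ []) → case ∃-triangle (k ∷ x ∷ []) 2<τ of λ
      { (d , (_ , j~d , i~d) , d≢k ∷ d≢x ∷ []) →
        C₅-free (pentagon i~d (~-sym j~d) j~x (~-sym k~x) (~-sym i~k)
          (~⇒≢ i~j) (x≢i ∘ sym) d≢x d≢k (~⇒≢ j~k)) } }

    -- `τ-heavy` bounds only the edge leaving the second end of the heavy edge, so each of the six
    -- ordered pairs of edges takes its own relabelling of the triangle.
    6≤shares : Triangle i j k → 6 ≤ share (τ i j) + (share (τ i k) + share (τ j k))
    6≤shares {i} {j} {k} t = share-sum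
      (triangle⇒0<τ t) (triangle⇒0<τ (swap₂₃ t)) (triangle⇒0<τ (swap₂₃ (swap₁₂ t)))
      (λ 2<τ → τ-heavy (swap₁₂ t) (subst (2 <_) (τ-sym i j) 2<τ) , τ-heavy t 2<τ)
      (λ 2<τ → τ-heavy (swap₁₂ (swap₂₃ t)) (subst (2 <_) (τ-sym i k) 2<τ) ,
               subst (_≤ 1) (τ-sym k j) (τ-heavy (swap₂₃ t) 2<τ))
      (λ 2<τ → subst (_≤ 1) (τ-sym j i) (τ-heavy t′ (subst (2 <_) (τ-sym j k) 2<τ)) ,
               subst (_≤ 1) (τ-sym k i) (τ-heavy (swap₂₃ (swap₁₂ t)) 2<τ))
      where t′ = swap₁₂ (swap₂₃ (swap₁₂ t))

    -- Sum `6≤shares` over the ordered triangles. An edge can occupy three positions in an ordered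
    -- triangle, and each position collects exactly `totalDegree`, whence the common factor 3.
    2*#orderedTriangles≤totalDegree : 2 * #orderedTriangles ≤ totalDegree
    2*#orderedTriangles≤totalDegree = *-cancelˡ-≤ 3 (begin
      3 * (2 * #orderedTriangles)
        ≡⟨ *-assoc 3 2 (#orderedTriangles) ⟨
      6 * #orderedTriangles
        ≡⟨ ∑³-distribˡ-* 6 (Δ) ⟩
      ∑³ (λ i j k → 6 * Δ i j k)
        ≤⟨ ∑³-mono-≤ discharge ⟩
      ∑³ (λ i j k → (s₁ i j k + (s₂ i j k + s₃ i j k)) * Δ i j k)
        ≡⟨ ∑³-cong (λ i j k → distrib (s₁ i j k) (s₂ i j k) (s₃ i j k) (Δ i j k)) ⟩
      ∑³ (λ i j k → s₁ i j k * Δ i j k + (s₂ i j k * Δ i j k + s₃ i j k * Δ i j k))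
        ≡⟨ ∑³-distrib-+ (λ i j k → s₁ i j k * Δ i j k) (λ i j k → s₂ i j k * Δ i j k + s₃ i j k * Δ i j k) ⟩
      T s₁ + ∑³ (λ i j k → s₂ i j k * Δ i j k + s₃ i j k * Δ i j k)
        ≡⟨ cong (T s₁ +_) (∑³-distrib-+ (λ i j k → s₂ i j k * Δ i j k) (λ i j k → s₃ i j k * Δ i j k)) ⟩
      T s₁ + (T s₂ + T s₃)
        ≡⟨ cong₂ _+_ T₁ (cong₂ _+_ T₂ T₃) ⟩
      totalDegree + (totalDegree + totalDegree)
        ≡⟨ cong (λ z → totalDegree + (totalDegree + z)) (+-identityʳ totalDegree) ⟨
      3 * totalDegree ∎)
      where
      open ≤-Reasoning
      s₁ s₂ s₃ : Fin n → Fin n → Fin n → ℕ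
      s₁ i j k = share (τ i j)
      s₂ i j k = share (τ i k)
      s₃ i j k = share (τ j k)
      T : (Fin n → Fin n → Fin n → ℕ) → ℕ
      T s = ∑³ λ i j k → s i j k * Δ i j k
      -- The share does not depend on `k`, so summing `Δ i j k` over `k` yields the factor `τ i j`
      -- of `W i j`.
      T₁ : T s₁ ≡ totalDegree
      T₁ = sum-cong-≗ λ i → sum-cong-≗ λ j →
        trans (sym (*-distribˡ-sum (share (τ i j)) (Δ i j))) (*-comm (share (τ i j)) (τ i j))
      T₂ : T s₂ ≡ totalDegree
      T₂ = trans (∑³-Δ-swap₂₃ s₂) T₁
      T₃ : T s₃ ≡ totalDegree
      T₃ = trans (∑³-Δ-swap₁₂ s₃) T₂
      distrib : ∀ a b c d → (a + (b + c)) * d ≡ a * d + (b * d + c * d)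
      distrib = solve-∀
      discharge : ∀ i j k → 6 * Δ i j k ≤ (s₁ i j k + (s₂ i j k + s₃ i j k)) * Δ i j k
      discharge i j k = *𝟙-mono-≤ (triangle? i j k) 6≤shares

    -- Otherwise x w u y v is a C₅.
    third-vertex : x ≢ y → ¬ x ~ y → Triangle x u w → u ~ y → x ~ v → v ~ y → u ≢ v → ¬ w ≢ v
    third-vertex x≢y x≁y (x~u , u~w , x~w) u~y x~v v~y u≢v w≢v =
      C₅-free (pentagon x~w (~-sym u~w) u~y (~-sym v~y) (~-sym x~v)
        (~⇒≢ x~u) x≢y (λ { refl → x≁y x~w }) w≢v u≢v)

    -- By `third-vertex`, `v` is the only possible third vertex of a triangle on `x u`.
    τ≤1 : x ≢ y → ¬ x ~ y → x ~ u → u ~ y → x ~ v → v ~ y → u ≢ v → τ x u ≤ 1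
    τ≤1 x≢y x≁y x~u u~y x~v v~y u≢v = ≮⇒≥ λ 1<τ → case ∃-triangle (_ ∷ []) 1<τ of λ
      { (w , t , w≢v ∷ []) → third-vertex x≢y x≁y t u~y x~v v~y u≢v w≢v }

    codegree-nonadjacent : x ≢ y → ¬ x ~ y → codegree x y ≤ 18
    -- The split is on the number `sum p` of paths of positive weight. A lone path may have two
    -- edges of weight 4; a second path forces weight at most 3 on each edge.
    codegree-nonadjacent {x} {y} x≢y x≁y = case sum p ≤? 1 of λ
      { (yes ∑p≤1) → begin
          codegree x y  ≤⟨ codegree≤*sum 16 (λ u _ → W*W≤16 x u y) ⟩
          16 * sum p    ≤⟨ *-monoʳ-≤ 16 ∑p≤1 ⟩
          16            ≤⟨ m≤m+n 16 2 ⟩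
          18            ∎
      ; (no ∑p≰1) → begin
          codegree x y  ≤⟨ codegree≤*sum 9 (several (≰⇒> ∑p≰1)) ⟩
          9 * sum p     ≤⟨ *-monoʳ-≤ 9 ∑p≤2 ⟩
          18            ∎
      }
      where
      open ≤-Reasoning
      positive? : ∀ u → Dec (0 < W x u * W u y)
      positive? u = 0 <? W x u * W u y
      p : Fin n → ℕ
      p u = 𝟙 (positive? u)

      codegree≤*sum : ∀ c → (∀ u → 0 < W x u * W u y → W x u * W u y ≤ c) → codegree x y ≤ c * sum p
      codegree≤*sum c ≤c = ≤-trans (sum-mono-≤ λ u → ≤-*𝟙 (positive? u) id (≤c u))
        (≤-reflexive (sym (*-distribˡ-sum c p)))

      -- The positive weight is returned too, because `∑p≤2` draws from it a triangle on the edge to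
      -- `x`.
      neighbour : ∀ us → length us < sum p → ∃[ v ] (0 < W x v × x ~ v × v ~ y) × All (v ≢_) us
      neighbour us len<∑p =
        let v , 0<pv , v∉us = ∃-outside p (λ u → 𝟙≤1 (positive? u)) us len<∑p
            0<WW = 0<𝟙⇒holds (positive? v) 0<pv
        in v , (m*n≢0⇒ 0<WW , 0<W*W⇒~ 0<WW) , v∉us
        where
        m*n≢0⇒ : ∀ {m n} → 0 < m * n → 0 < m
        m*n≢0⇒ {suc m} _ = s≤s z≤n

      several : 1 < sum p → ∀ u → 0 < W x u * W u y → W x u * W u y ≤ 9
      several 1<∑p u 0<WW =
        let x~u , u~y = 0<W*W⇒~ 0<WW in case neighbour (u ∷ []) 1<∑p of λ
        { (v , (_ , x~v , v~y) , v≢u ∷ []) → let u≢v = v≢u ∘ sym in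
          *-mono-≤ (*-share≤3 (τ≤1 x≢y x≁y x~u u~y x~v v~y u≢v))
            -- For the edge `u y`, `τ≤1` is applied with the ends `x` and `y` exchanged.
            (*-share≤3 (≤-trans (≤-reflexive (τ-sym u y))
              (τ≤1 (x≢y ∘ sym) (x≁y ∘ ~-sym) (~-sym u~y) (~-sym x~u) (~-sym v~y) (~-sym x~v) u≢v))) }

      -- The third vertex of a triangle on xu would equal both other common neighbours.
      ∑p≤2 : sum p ≤ 2
      ∑p≤2 = ≮⇒≥ λ 2<∑p → case neighbour [] (≤-trans (s≤s z≤n) 2<∑p) of λ
        { (u , (0<W , x~u , u~y) , []) → case neighbour (u ∷ []) (≤-trans (s≤s (s≤s z≤n)) 2<∑p) of λ
        { (v , (_ , x~v , v~y) , v≢u ∷ []) → case neighbour (u ∷ v ∷ []) 2<∑p of λ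
        { (v′ , (_ , x~v′ , v′~y) , v′≢u ∷ v′≢v ∷ []) →
          let w , t , _ = ∃-triangle [] (0<W⇒0<τ 0<W)
          in third-vertex x≢y x≁y t u~y x~v v~y (v≢u ∘ sym) λ w≡v →
               third-vertex x≢y x≁y t u~y x~v′ v′~y (v′≢u ∘ sym) λ w≡v′ → v′≢v (trans (sym w≡v′) w≡v) } } }

    -- The bounds for nonadjacent, adjacent and equal pairs are added into one formula, which can be
    -- summed without splitting the index set.
    codegree≤ : ∀ x y → codegree x y ≤ 18 + (16 * τ x y + 𝟙 (x ≟ y) * (4 * degree x))
    codegree≤ x y with x ≟ y
    ... | yes refl = ≤-trans (codegree-diagonal x)
      (≤-trans (≤-reflexive (sym (+-identityʳ _))) (m≤n⇒m≤o+n 18 (m≤n+m _ (16 * τ x x))))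
    ... | no x≢y = case x ~? y of λ
      { (yes x~y) → ≤-trans (codegree-adjacent x~y) (m≤n⇒m≤o+n 18 (m≤m+n (16 * τ x y) 0))
      ; (no x≁y)  → ≤-trans (codegree-nonadjacent x≢y x≁y) (m≤m+n 18 (16 * τ x y + 0)) }

    -- The 12 is 8 + 4: adjacent pairs cost `16 * #orderedTriangles`, at most `8 * totalDegree`, and
    -- the diagonal costs `4 * totalDegree`.
    ∑-codegree≤ : ∑[ x < n ] ∑[ y < n ] codegree x y ≤ n * n * 18 + 12 * totalDegree
    ∑-codegree≤ = begin
      ∑[ x < n ] ∑[ y < n ] codegree x y
        ≤⟨ sum-mono-≤ row ⟩
      ∑[ x < n ] (n * 18 + (16 * sum (τ x) + 4 * degree x))
        ≡⟨ ∑-distrib-+ {n} (λ _ → n * 18) (λ x → 16 * sum (τ x) + 4 * degree x) ⟩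
      (∑[ x < n ] (n * 18)) + (∑[ x < n ] (16 * sum (τ x) + 4 * degree x))
        ≡⟨ cong₂ _+_ (sum-const n (n * 18)) (∑-distrib-+ (λ x → 16 * sum (τ x)) (λ x → 4 * degree x)) ⟩
      n * (n * 18) + ((∑[ x < n ] (16 * sum (τ x))) + (∑[ x < n ] (4 * degree x)))
        ≡⟨ cong₂ _+_ (*-assoc n n 18) (cong₂ _+_
             (*-distribˡ-sum 16 (λ x → sum (τ x))) (*-distribˡ-sum 4 degree)) ⟨
      n * n * 18 + (16 * #orderedTriangles + 4 * totalDegree)
        ≡⟨ cong (λ z → n * n * 18 + (z + 4 * totalDegree)) (*-assoc 8 2 (#orderedTriangles)) ⟩
      n * n * 18 + (8 * (2 * #orderedTriangles) + 4 * totalDegree)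
        ≤⟨ +-monoʳ-≤ (n * n * 18) (+-monoˡ-≤ (4 * totalDegree) (*-monoʳ-≤ 8 2*#orderedTriangles≤totalDegree)) ⟩
      n * n * 18 + (8 * totalDegree + 4 * totalDegree)
        ≡⟨ cong (n * n * 18 +_) (*-distribʳ-+ totalDegree 8 4) ⟨
      n * n * 18 + 12 * totalDegree ∎
      where
      open ≤-Reasoning
      row : ∀ x → ∑[ y < n ] codegree x y ≤ n * 18 + (16 * sum (τ x) + 4 * degree x)
      row x = begin
        ∑[ y < n ] codegree x y
          ≤⟨ sum-mono-≤ (codegree≤ x) ⟩
        ∑[ y < n ] (18 + (16 * τ x y + 𝟙 (x ≟ y) * (4 * degree x)))
          ≡⟨ ∑-distrib-+ {n} (λ _ → 18) _ ⟩
        (∑[ y < n ] 18) + (∑[ y < n ] (16 * τ x y + 𝟙 (x ≟ y) * (4 * degree x)))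
          ≡⟨ cong₂ _+_ (sum-const n 18) (∑-distrib-+ (λ y → 16 * τ x y) _) ⟩
        n * 18 + ((∑[ y < n ] (16 * τ x y)) + (∑[ y < n ] (𝟙 (x ≟ y) * (4 * degree x))))
          ≡⟨ cong (n * 18 +_) (cong₂ _+_ (*-distribˡ-sum 16 (τ x))
               (*-distribʳ-sum (4 * degree x) (λ y → 𝟙 (x ≟ y)))) ⟨
        n * 18 + (16 * sum (τ x) + (∑[ y < n ] 𝟙 (x ≟ y)) * (4 * degree x))
          ≡⟨ cong (λ z → n * 18 + (16 * sum (τ x) + z))
               (trans (cong (_* (4 * degree x)) (sum-𝟙-≟ x)) (*-identityˡ (4 * degree x))) ⟩
        n * 18 + (16 * sum (τ x) + 4 * degree x) ∎

    totalDegree²≤ : totalDegree * totalDegree ≤ n * (n * n * 18 + 12 * totalDegree)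
    totalDegree²≤ = begin
      totalDegree * totalDegree                   ≤⟨ cauchy-schwarz degree ⟩
      n * ∑[ i < n ] (degree i * degree i)        ≡⟨ cong (n *_) ∑-degree² ⟩
      n * ∑[ x < n ] ∑[ y < n ] codegree x y      ≤⟨ *-monoʳ-≤ n ∑-codegree≤ ⟩
      n * (n * n * 18 + 12 * totalDegree)         ∎
      where open ≤-Reasoning

    12*#triangles≤totalDegree : 12 * #triangles G ≤ totalDegree
    12*#triangles≤totalDegree = begin
      12 * #triangles G          ≡⟨ *-assoc 2 6 (#triangles G) ⟩
      2 * (6 * #triangles G)     ≤⟨ *-monoʳ-≤ 2 (6*#triangles≤#orderedTriangles) ⟩
      2 * #orderedTriangles    ≤⟨ 2*#orderedTriangles≤totalDegree ⟩
      totalDegree                ∎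
      where open ≤-Reasoning

-- Integer square roots and the numerical estimate

open ℤ using (+_)

-- Passing from `n` to `suc n` raises the root by at most one, so it suffices to test `suc r`.
isqrt : ∀ n → ∃[ r ] r * r ≤ n × n < suc r * suc r
isqrt zero = 0 , z≤n , s≤s z≤n
isqrt (suc n) with isqrt n
... | r , r²≤n , n<[1+r]² with suc r * suc r ≤? suc n
...   | yes [1+r]²≤1+n = suc r , [1+r]²≤1+n , ≤-<-trans n<[1+r]² (*-mono-< (n<1+n (suc r)) (n<1+n (suc r)))
...   | no  [1+r]²≰1+n = r , m≤n⇒m≤1+n r²≤n , ≰⇒> [1+r]²≰1+n

√_ : ℕ → ℕ
√ n = proj₁ (isqrt n)

-- For `n ≥ 1` the integer root `r` is positive, so `1 + r ≤ r + r`.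
[1+√n]²≤4n : ∀ {n} → n ≥ 1 → suc (√ n) * suc (√ n) ≤ 4 * n
[1+√n]²≤4n {n} n≥1 with isqrt n
... | zero , _ , n<1 = contradiction n<1 (≤⇒≯ n≥1)
... | r@(suc q) , r²≤n , _ = begin
  suc r * suc r      ≤⟨ *-mono-≤ (s≤s (m≤n+m r q)) (s≤s (m≤n+m r q)) ⟩
  (r + r) * (r + r)  ≡⟨ identity r ⟩
  4 * (r * r)        ≤⟨ *-monoʳ-≤ 4 r²≤n ⟩
  4 * n              ∎
  where
  open ≤-Reasoning
  identity : ∀ r → (r + r) * (r + r) ≡ 4 * (r * r)
  identity = solve-∀

m²≤n²⇒m≤n : ∀ {m n} → m * m ≤ n * n → m ≤ n
m²≤n²⇒m≤n m²≤n² = ≮⇒≥ λ n<m → <⇒≱ (*-mono-< n<m n<m) m²≤n²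

-- Moving `12 * n * s` to the left gives `(s ∸ 12 * n) * s ≤ 18 * (n * n * n)`, and `12 * (t ∸ n)`
-- is at most either factor; finally 144 = 18 · 8. Truncated subtraction covers `t < n`.
8*[t∸n]²≤n³ : ∀ n t s → 12 * t ≤ s → s * s ≤ n * (n * n * 18 + 12 * s) →
  8 * ((t ∸ n) * (t ∸ n)) ≤ n * n * n
8*[t∸n]²≤n³ n t s 12t≤s s²≤ = *-cancelˡ-≤ 18 (begin
  18 * (8 * (u * u))        ≡⟨ regroup u ⟩
  (12 * u) * (12 * u)       ≤⟨ *-mono-≤ 12u≤v (≤-trans 12u≤v (m∸n≤m s (12 * n))) ⟩
  v * s                     ≡⟨ *-distribʳ-∸ s s (12 * n) ⟩
  s * s ∸ 12 * n * s        ≤⟨ ∸-monoˡ-≤ (12 * n * s) s²≤ ⟩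
  n * (n * n * 18 + 12 * s) ∸ 12 * n * s  ≡⟨ cong (_∸ 12 * n * s) (expand n s) ⟩
  18 * (n * n * n) + 12 * n * s ∸ 12 * n * s  ≡⟨ m+n∸n≡m (18 * (n * n * n)) (12 * n * s) ⟩
  18 * (n * n * n)          ∎)
  where
  open ≤-Reasoning
  u v : ℕ
  u = t ∸ n
  v = s ∸ 12 * n
  12u≤v : 12 * u ≤ v
  12u≤v = ≤-trans (≤-reflexive (*-distribˡ-∸ 12 t n)) (∸-monoˡ-≤ (12 * n) 12t≤s)
  regroup : ∀ u → 18 * (8 * (u * u)) ≡ (12 * u) * (12 * u)
  regroup = solve-∀
  expand : ∀ n s → n * (n * n * 18 + 12 * s) ≡ 18 * (n * n * n) + 12 * n * s
  expand = solve-∀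

-- Expand the square of `u + n`, which is at least `t`. The three resulting terms are at most `n³`
-- times `K²`, `12K` and 32, and `K² + 12K + 32` lies below `(K + 6)²`. Half of the 12 is the
-- numerator of `ε`.
8*t²*K²≤ : ∀ n t K → K * K ≤ 4 * n → 8 * ((t ∸ n) * (t ∸ n)) ≤ n * n * n →
  8 * (t * t) * (K * K) ≤ (K + 6) * (K + 6) * (n * n * n)
8*t²*K²≤ n t K K²≤4n 8u²≤n³ = begin
  8 * (t * t) * (K * K)
    ≤⟨ *-monoˡ-≤ (K * K) (*-monoʳ-≤ 8 (*-mono-≤ t≤u+n t≤u+n)) ⟩
  8 * ((u + n) * (u + n)) * (K * K)
    ≡⟨ expand n u K ⟩
  8 * (u * u) * (K * K) + (n * K * (16 * u * K) + 8 * (n * n) * (K * K))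
    ≤⟨ +-mono-≤ (*-monoˡ-≤ (K * K) 8u²≤n³)
         (+-mono-≤ (*-monoʳ-≤ (n * K) 16uK≤12n²) (*-monoʳ-≤ (8 * (n * n)) K²≤4n)) ⟩
  n * n * n * (K * K) + (n * K * (12 * (n * n)) + 8 * (n * n) * (4 * n))
    ≤⟨ m+n≤o⇒m≤o _ (≤-reflexive (collect n K)) ⟩
  (K + 6) * (K + 6) * (n * n * n) ∎
  where
  open ≤-Reasoning
  u : ℕ
  u = t ∸ n
  t≤u+n : t ≤ u + n
  t≤u+n = ≤-trans (m≤n+m∸n t n) (≤-reflexive (+-comm n u))
  square : ∀ u K → 16 * u * K * (16 * u * K) ≡ 32 * (8 * (u * u) * (K * K))
  square = solve-∀
  fourth : ∀ n → 32 * (n * n * n * (4 * n)) + 16 * (n * n * (n * n)) ≡ 12 * (n * n) * (12 * (n * n))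
  fourth = solve-∀
  expand : ∀ n u K → 8 * ((u + n) * (u + n)) * (K * K) ≡
    8 * (u * u) * (K * K) + (n * K * (16 * u * K) + 8 * (n * n) * (K * K))
  expand = solve-∀
  collect : ∀ n K → n * n * n * (K * K) + (n * K * (12 * (n * n)) + 8 * (n * n) * (4 * n)) +
    4 * (n * n * n) ≡ (K + 6) * (K + 6) * (n * n * n)
  collect = solve-∀
  16uK≤12n² : 16 * u * K ≤ 12 * (n * n)
  -- The square of the left side is at most `128 n⁴`, and 12 is the least integer whose square is at
  -- least 128.
  16uK≤12n² = m²≤n²⇒m≤n (begin
    16 * u * K * (16 * u * K)        ≡⟨ square u K ⟩
    32 * (8 * (u * u) * (K * K))     ≤⟨ *-monoʳ-≤ 32 (*-mono-≤ 8u²≤n³ K²≤4n) ⟩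
    32 * (n * n * n * (4 * n))       ≤⟨ m+n≤o⇒m≤o _ (≤-reflexive (fourth n)) ⟩
    12 * (n * n) * (12 * (n * n))    ∎)

-- The rational error term and the final inequality

-- t ≤ n + √(n³/8) is a relative error of √(8/n), and (1 + ⌊√n⌋)² ≤ 4n.
ε : ℕ → ℚ
ε n = + 6 / suc (√ n)

ε→0 : TendsToZero ε
-- `N` is 6 times the denominator of `δ`. From `n ≥ N * N` follows `1 + √ n > N`, and the numerator
-- of `δ` is at least 1.
ε→0 δ@(mkℚ (+ suc a) d-1 _) _ = N * N , λ n N²≤n → subst (ℚ._< δ) (sym (ℚₚ.0≤p⇒∣p∣≡p (0≤ε n)))
    (ℚₚ.toℚᵘ-cancel-< (ℚᵘₚ.<-respˡ-≃ (ℚᵘₚ.≃-sym (ℚₚ.toℚᵘ-fromℚᵘ (mkℚᵘ (+ 6) (√ n))))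
      (ℚᵘ.*<* (subst₂ ℤ._<_ (ℤₚ.pos-* 6 (suc d-1)) (ℤₚ.pos-* (suc a) (suc (√ n)))
        (ℤ.+<+ (≤-trans (N<1+√ n N²≤n) (m≤m+n _ _)))))))
  where
  N : ℕ
  N = 6 * suc d-1
  0≤ε : ∀ n → 0ℚ ℚ.≤ ε n
  0≤ε n = ℚₚ.nonNegative⁻¹ (ε n) {{ℚₚ.normalize-nonNeg 6 (suc (√ n))}}
  N<1+√ : ∀ n → N * N ≤ n → N < suc (√ n)
  N<1+√ n N²≤n = ≰⇒> λ 1+√≤N → <⇒≱ (proj₂ (proj₂ (isqrt n))) (≤-trans (*-mono-≤ 1+√≤N 1+√≤N) N²≤n)
ε→0 (mkℚ (+ zero) _ _) (ℚ.*<* (ℤ.+<+ ()))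
ε→0 (mkℚ ℤ.-[1+ _ ] _ _) (ℚ.*<* ())

-- Clear denominators using 1 + 6/K = (K + 6)/K with K = `suc k`. The computation takes place in
-- `ℚᵘ`, where numerators and denominators stay explicit instead of being reduced.
≤·√-from-ℕ : ∀ t m k → 8 * (t * t) * (suc k * suc k) ≤ (suc k + 6) * (suc k + 6) * m →
  t ≤ 1ℚ ℚ.+ + 6 / suc k ·√ (+ m / 8)
≤·√-from-ℕ t m k h = 0≤q , ℚₚ.toℚᵘ-cancel-≤ (begin
  ℚ.toℚᵘ (+ t / 1 ℚ.* (+ t / 1))
    ≃⟨ ℚₚ.toℚᵘ-homo-* (+ t / 1) (+ t / 1) ⟩
  ℚ.toℚᵘ (+ t / 1) ℚᵘ.* ℚ.toℚᵘ (+ t / 1)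
    ≃⟨ ℚᵘₚ.*-cong (ℚₚ.toℚᵘ-fromℚᵘ (mkℚᵘ (+ t) 0)) (ℚₚ.toℚᵘ-fromℚᵘ (mkℚᵘ (+ t) 0)) ⟩
  mkℚᵘ (+ t) 0 ℚᵘ.* mkℚᵘ (+ t) 0
    ≤⟨ ℚᵘ.*≤* (subst₂ ℤ._≤_ lhs rhs (ℤ.+≤+ h′)) ⟩
  qᵘ ℚᵘ.* qᵘ ℚᵘ.* mkℚᵘ (+ m) 7
    ≃⟨ ℚᵘₚ.*-cong (ℚᵘₚ.*-cong q≃ q≃) (ℚₚ.toℚᵘ-fromℚᵘ (mkℚᵘ (+ m) 7)) ⟨
  ℚ.toℚᵘ q ℚᵘ.* ℚ.toℚᵘ q ℚᵘ.* ℚ.toℚᵘ (+ m / 8)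
    ≃⟨ ℚᵘₚ.*-congʳ (ℚₚ.toℚᵘ-homo-* q q) ⟨
  ℚ.toℚᵘ (q ℚ.* q) ℚᵘ.* ℚ.toℚᵘ (+ m / 8)
    ≃⟨ ℚₚ.toℚᵘ-homo-* (q ℚ.* q) (+ m / 8) ⟨
  ℚ.toℚᵘ (q ℚ.* q ℚ.* (+ m / 8)) ∎)
  where
  open ℚᵘₚ.≤-Reasoning
  q : ℚ
  q = 1ℚ ℚ.+ + 6 / suc k
  qᵘ : ℚᵘ
  qᵘ = mkℚᵘ (+ (suc k + 6)) k
  q≃ : ℚ.toℚᵘ q ℚᵘ.≃ qᵘ
  q≃ = ℚᵘₚ.≃-trans (ℚₚ.toℚᵘ-homo-+ 1ℚ (+ 6 / suc k))
    (ℚᵘₚ.≃-trans (ℚᵘₚ.+-congʳ ℚᵘ.1ℚᵘ (ℚₚ.toℚᵘ-fromℚᵘ (mkℚᵘ (+ 6) k)))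
      (ℚᵘ.*≡* (cong +_ (trans (cong (λ z → (suc z + 6) * suc k) (+-identityʳ k))
        (sym (cong (λ z → (suc k + 6) * suc z) (+-identityʳ k)))))))
  0≤q : 0ℚ ℚ.≤ q
  0≤q = ℚₚ.toℚᵘ-cancel-≤ (ℚᵘₚ.≤-respʳ-≃ (ℚᵘₚ.≃-sym q≃) (ℚᵘₚ.nonNegative⁻¹ qᵘ))
  h′ : t * t * (suc k * suc k * 8) ≤ (suc k + 6) * (suc k + 6) * m * 1
  h′ = ≤-trans (≤-reflexive (regroup t (suc k))) (≤-trans h (≤-reflexive (sym (*-identityʳ _))))
    where
    regroup : ∀ t K → t * t * (K * K * 8) ≡ 8 * (t * t) * (K * K)
    regroup = solve-∀
  lhs : + (t * t * (suc k * suc k * 8)) ≡ (+ t ℤ.* + t) ℤ.* + (suc k * suc k * 8)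
  lhs = trans (ℤₚ.pos-* (t * t) _) (cong (ℤ._* + (suc k * suc k * 8)) (ℤₚ.pos-* t t))
  rhs : + ((suc k + 6) * (suc k + 6) * m * 1) ≡ (+ (suc k + 6) ℤ.* + (suc k + 6)) ℤ.* + m ℤ.* + 1
  rhs = trans (ℤₚ.pos-* ((suc k + 6) * (suc k + 6) * m) 1) (cong (ℤ._* + 1)
    (trans (ℤₚ.pos-* ((suc k + 6) * (suc k + 6)) m) (cong (ℤ._* + m) (ℤₚ.pos-* (suc k + 6) (suc k + 6)))))

-- The radicand n³/8 is the square of n^(3/2) / (2√2), which keeps the bound within rational data.
theorem1 : Σ[ ε ∈ (ℕ → ℚ) ] (TendsToZero ε ×
    (∀ n → n ≥ 1 → (G : Graph n) → C₅-Free G →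
    #triangles G ≤ 1ℚ ℚ.+ ε n ·√ (+ (n ^ 3) / 8)))
theorem1 = ε , ε→0 , λ n n≥1 G C₅-free →
  ≤·√-from-ℕ (#triangles G) (n ^ 3) (√ n)
    (subst (λ n³ → 8 * (#triangles G * #triangles G) * (suc (√ n) * suc (√ n)) ≤
                   (suc (√ n) + 6) * (suc (√ n) + 6) * n³)
      (cube n)
      (8*t²*K²≤ n (#triangles G) (suc (√ n)) ([1+√n]²≤4n n≥1)
        (8*[t∸n]²≤n³ n (#triangles G) (totalDegree G)
          (12*#triangles≤totalDegree G C₅-free) (totalDegree²≤ G C₅-free))))
  where
  cube : ∀ n → n * n * n ≡ n ^ 3
  cube n = trans (*-assoc n n n) (cong (λ z → n * (n * z)) (sym (*-identityʳ n)))
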